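{- For every fixed integer $a\geq 2$, the limit \[ \lim_{q\rightarrow\infty}\frac{\chi_{sc2}(K_{a,q})-2q}{\sqrt{q}} \] exists.
   Context: $K_{a,q}$ is the complete bipartite graph with parts $A$, $|A|=a$, and $Q$, $|Q|=q$. For a graph $G=(V,E)$ and $f:V\to\mathbb{N}$, an $f$-assignment is an assignment of color lists $L(v)$ with $|L(v)|=f(v)$; $G$ is $f$-choosable if for every $f$-assignment $L$ there is a proper coloring $c$ with $c(v)\in L(v)$ for all $v$. A function $f$ on $V(K_{a,q})$ is of type II if $f(v)=2$ for all $v\in Q$. $\chi_{sc2}(K_{a,q})$ is the minimum of $\sum_{v\in A\cup Q}f(v)$ over all type II functions $f$ such that $K_{a,q}$ is $f$-choosable. -}

module Defs where

open import Data.Nat as ℕ using (ℕ; suc)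
open import Data.Fin using (Fin)
open import Data.Sum using (_⊎_; inj₁; inj₂)
open import Data.Product using (Σ; _×_; ∃; ∃-syntax)
open import Data.List using (List; length; map; allFin)
open import Data.Nat.ListAction using (sum)
open import Data.List.Membership.Propositional using (_∈_)
open import Data.List.Relation.Unary.Unique.Propositional using (Unique)
open import Data.Integer using (+_)
open import Data.Rational as ℚ using (ℚ; _/_; 0ℚ)
open import Relation.Binary.PropositionalEquality using (_≡_; _≢_)
open import Relation.Nullary using (¬_)

IsAssignment : {V : Set} → (V → ℕ) → (V → List ℕ) → Set
IsAssignment {V} f L = (v : V) → Unique (L v) × length (L v) ≡ f v

IsProperLColoring : {V : Set} → (V → V → Set) → (V → List ℕ) → (V → ℕ) → Set
IsProperLColoring {V} Adj L c =
  ((v : V) → c v ∈ L v) × ((u v : V) → Adj u v → c u ≢ c v)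

Choosable : {V : Set} → (V → V → Set) → (V → ℕ) → Set
Choosable {V} Adj f =
  (L : V → List ℕ) → IsAssignment f L → ∃[ c ] IsProperLColoring Adj L c

KV : ℕ → ℕ → Set
KV a q = Fin a ⊎ Fin q

data KAdj {a q : ℕ} : KV a q → KV a q → Set where
  aq : (i : Fin a) (j : Fin q) → KAdj (inj₁ i) (inj₂ j)
  qa : (i : Fin a) (j : Fin q) → KAdj (inj₂ j) (inj₁ i)

TypeII : {a q : ℕ} → (KV a q → ℕ) → Set
TypeII {a} {q} f = (j : Fin q) → f (inj₂ j) ≡ 2

weight : {a q : ℕ} → (KV a q → ℕ) → ℕ
weight {a} {q} f =
  sum (map (λ i → f (inj₁ i)) (allFin a)) ℕ.+ sum (map (λ j → f (inj₂ j)) (allFin q))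

IsChiSc2 : ℕ → ℕ → ℕ → Set
IsChiSc2 a q m =
  (Σ (KV a q → ℕ) λ f → TypeII f × Choosable KAdj f × weight f ≡ m)
  × ((f : KV a q → ℕ) → TypeII f → Choosable KAdj f → m ℕ.≤ weight f)

ℕ→ℚ : ℕ → ℚ
ℕ→ℚ n = + n / 1

-- For d ∈ ℕ and q ≥ 1 (so d/√q ≥ 0), comparisons of a rational with d/√q,
-- by squaring:
-- r ≤ d/√q  iff  r ≤ 0 or r²·q ≤ d²
_≤d/√_[_] : ℚ → ℕ → ℕ → Set
r ≤d/√ q [ d ] = r ℚ.≤ 0ℚ ⊎ (r ℚ.* r ℚ.* ℕ→ℚ q) ℚ.≤ ℕ→ℚ (d ℕ.* d)

d/√_[_]≤_ : ℕ → ℕ → ℚ → Set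
d/√ q [ d ]≤ s = 0ℚ ℚ.≤ s × ℕ→ℚ (d ℕ.* d) ℚ.≤ (s ℚ.* s ℚ.* ℕ→ℚ q)

-- The sequence q ↦ x q / √q (q ≥ 1) converges to a finite real limit,
-- expressed by the (equivalent) Cauchy criterion over rational intervals:
-- for every rational ε > 0 there are r ∈ ℚ and N such that for all q ≥ max(N,1),
-- r ≤ x q / √q ≤ r + ε.
ConvergesOverSqrt : (ℕ → ℕ) → Set
ConvergesOverSqrt x =
  (ε : ℚ) → 0ℚ ℚ.< ε →
  ∃[ r ] ∃[ N ] ((q : ℕ) → N ℕ.≤ q → 1 ℕ.≤ q →
     (r ≤d/√ q [ x q ]) × (d/√ q [ x q ]≤ (r ℚ.+ ε)))

{-# OPTIONS --safe #-}

-- View the lists on Q as the edges of a graph on the colours: a colouring of A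
-- extends to Q iff its colours contain no edge. Let d(q) = χ(q) − 2q, the least
-- total list size on A that beats every graph with q edges. Then, for k ≥ 1,
--
--   k (d(q) − a) ≤ d(k² q) ≤ k (d(q) + a 2ᵃ).
--
-- Lower bound: replacing each colour by k clones turns q edges into k² q.
-- Upper bound: group colours lying in exactly the same lists into blocks of
-- size k, which wastes fewer than k colours for each of the 2ᵃ types, and pick
-- a random colour in each block. An edge survives with probability at most
-- 1/k², so some choice leaves at most q of the k² q edges, while the lists
-- shrink only by a factor k.
--
-- As d is monotone, d(r)/√r for large r lies within O(1/p) of d(p²)/p, which
-- is the Cauchy criterion.

module Submission where

open import Defs
open import Algebra.Properties.CommutativeSemigroup using (interchange)
open import Data.Fin using (Fin; zero; suc; toℕ; cast)
open import Data.Fin.Properties using (any?; injective⇒≤; toℕ<n; toℕ-injective; toℕ-cast)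
import Data.Integer as ℤ
import Data.Integer.Properties as ℤₚ
open import Data.List using (List; []; _∷_; _++_; length; map; concat; filter; lookup; partition; tabulate; deduplicate; cartesianProductWith; cartesianProduct; allFin; take; replicate)
open import Data.List.Properties using (length-++; length-map; length-tabulate; length-take; length-replicate; map-cong; filter-++; length-filter; filter-accept; filter-reject; filter-none; ++-assoc; ++-identityʳ; concat-++)
open import Data.List.Membership.DecPropositional using () renaming (_∈?_ to member?)
open import Data.List.Membership.Propositional using (_∈_; _∉_)
open import Data.List.Membership.Propositional.Properties using (∈-lookup; ∈-++⁺ˡ; ∈-++⁺ʳ; ∈-filter⁺; ∈-filter⁻; ∈-concat⁺′; ∈-tabulate⁺; ∈-deduplicate⁺; ∈-allFin; ∈-cartesianProductWith⁺; ∈-cartesianProductWith⁻; ∈-cartesianProduct⁺)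
open import Data.List.Relation.Binary.Disjoint.Propositional using (Disjoint)
open import Data.List.Relation.Binary.Permutation.Propositional using (_↭_; prep; ↭-refl; ↭-sym; ↭-trans; ↭⇒↭ₛ; ↭ₛ⇒↭; module PermutationReasoning)
open import Data.List.Relation.Binary.Permutation.Propositional.Properties using (All-resp-↭; shift; shifts; ↭-length; filter-↭) renaming (++⁺ to ↭-++⁺; ++-comm to ↭-++-comm; ++⁺ˡ to ↭-++⁺ˡ)
import Data.List.Relation.Binary.Permutation.Setoid.Properties as Permₛ
open import Data.List.Relation.Binary.Pointwise using (Pointwise; []; _∷_)
open import Data.List.Relation.Unary.All as All using (All; []; _∷_)
import Data.List.Relation.Unary.All.Properties as Allₚ
open import Data.List.Relation.Unary.AllPairs using ([]; _∷_)
open import Data.List.Relation.Unary.Any using (here; there; index)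
open import Data.List.Relation.Unary.Any.Properties using (lookup-index)
open import Data.List.Relation.Unary.Unique.DecPropositional.Properties using (deduplicate-!)
open import Data.List.Relation.Unary.Unique.Propositional using (Unique)
import Data.List.Relation.Unary.Unique.Propositional.Properties as Uniqueₚ
open import Data.Nat using (ℕ; zero; suc; pred; _+_; _*_; _^_; _∸_; _/_; _≤_; _<_; z≤n; s≤s; NonZero; _≟_; _≤?_; _<?_)
open import Data.Nat.DivMod using (m<n⇒m/n≡0; m*n/n≡m; m/n*n≤m; +-distrib-/-∣ˡ; m≡m%n+[m/n]*n; m%n<n)
open import Data.Nat.Divisibility using (n∣m*n)
open import Data.Nat.ListAction using (sum)
open import Data.Nat.Properties hiding (_≟_; _≤?_; _<?_)
open import Data.Nat.Solver using (module +-*-Solver)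
open import Data.Product using (_×_; _,_; ∃-syntax; proj₁; proj₂; uncurry)
open import Data.Rational as ℚ using (ℚ; 0ℚ; mkℚ)
import Data.Rational.Properties as ℚₚ
import Data.Rational.Unnormalised as ℚᵘ
import Data.Rational.Unnormalised.Properties as ℚᵘₚ
open import Data.Sum using (_⊎_; inj₁; inj₂; [_,_]′)
open import Function using (_∘_; id)
open import Relation.Binary.PropositionalEquality using (_≡_; _≢_; refl; sym; trans; cong; cong₂; subst; subst₂; setoid; module ≡-Reasoning)
open import Relation.Nullary using (¬_; Dec; yes; no; contradiction; _×-dec_)
open import Relation.Unary using (Decidable)

-- Lists: uniqueness, permutations and sums.

+-interchange : ∀ m n o p → (m + n) + (o + p) ≡ (m + o) + (n + p)
+-interchange = interchange +-commutativeSemigroup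

_∈?_ : (x : ℕ) (xs : List ℕ) → Dec (x ∈ xs)
_∈?_ = member? _≟_

module _ {A : Set} where

  Unique-++⁻ : (xs : List A) {ys : List A} → Unique (xs ++ ys) →
               Unique xs × Unique ys × Disjoint xs ys
  Unique-++⁻ []       ys!           = [] , ys! , λ { (() , _) }
  Unique-++⁻ (x ∷ xs) (x∉ ∷ xs++ys!) with Unique-++⁻ xs xs++ys!
  ... | xs! , ys! , xs#ys = Allₚ.++⁻ˡ xs x∉ ∷ xs! , ys! , λ
    { (here refl , v∈ys) → All.lookup (Allₚ.++⁻ʳ xs x∉) v∈ys refl
    ; (there v∈xs , v∈ys) → xs#ys (v∈xs , v∈ys) }

  Unique-resp-↭ : {xs ys : List A} → xs ↭ ys → Unique xs → Unique ys
  Unique-resp-↭ = Permₛ.Unique-resp-↭ (setoid A) ∘ ↭⇒↭ₛ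

  Unique⇒lookup-injective : {xs : List A} → Unique xs → ∀ {i j} →
                            lookup xs i ≡ lookup xs j → i ≡ j
  Unique⇒lookup-injective (x∉ ∷ xs!) {zero}  {zero}  eq = refl
  Unique⇒lookup-injective (x∉ ∷ xs!) {zero}  {suc j} eq = contradiction eq (All.lookup x∉ (∈-lookup j))
  Unique⇒lookup-injective (x∉ ∷ xs!) {suc i} {zero}  eq = contradiction (sym eq) (All.lookup x∉ (∈-lookup i))
  Unique⇒lookup-injective (x∉ ∷ xs!) {suc i} {suc j} eq = cong suc (Unique⇒lookup-injective xs! eq)

  Unique-⊆⇒length-≤ : {xs ys : List A} → Unique xs → (∀ {x} → x ∈ xs → x ∈ ys) →
                      length xs ≤ length ys
  Unique-⊆⇒length-≤ {xs} {ys} xs! xs⊆ys = injective⇒≤ {f = f} λ {i} {j} eq →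
    Unique⇒lookup-injective xs! (begin
      lookup xs i      ≡⟨ lookup-index (xs⊆ys (∈-lookup i)) ⟩
      lookup ys (f i)  ≡⟨ cong (lookup ys) eq ⟩
      lookup ys (f j)  ≡⟨ lookup-index (xs⊆ys (∈-lookup j)) ⟨
      lookup xs j      ∎)
    where
    open ≡-Reasoning
    f : Fin (length xs) → Fin (length ys)
    f i = index (xs⊆ys (∈-lookup i))

  ++-interchange-↭ : (ws xs ys zs : List A) →
                     (ws ++ xs) ++ (ys ++ zs) ↭ (ws ++ ys) ++ (xs ++ zs)
  ++-interchange-↭ ws xs ys zs = begin
    (ws ++ xs) ++ (ys ++ zs)  ≡⟨ ++-assoc ws xs (ys ++ zs) ⟩
    ws ++ xs ++ ys ++ zs      ↭⟨ ↭-++⁺ˡ ws (shifts xs ys) ⟩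
    ws ++ ys ++ xs ++ zs      ≡⟨ ++-assoc ws ys (xs ++ zs) ⟨
    (ws ++ ys) ++ (xs ++ zs)  ∎
    where open PermutationReasoning

  sum-map-+ : (f g : A → ℕ) (xs : List A) →
              sum (map (λ x → f x + g x) xs) ≡ sum (map f xs) + sum (map g xs)
  sum-map-+ f g []       = refl
  sum-map-+ f g (x ∷ xs) = trans (cong (f x + g x +_) (sum-map-+ f g xs))
    (+-interchange (f x) (g x) (sum (map f xs)) (sum (map g xs)))

  sum-map-≤ : {f : A → ℕ} {m : ℕ} (xs : List A) → (∀ {x} → x ∈ xs → f x ≤ m) →
              sum (map f xs) ≤ length xs * m
  sum-map-≤ []       f≤m = z≤n
  sum-map-≤ (x ∷ xs) f≤m = +-mono-≤ (f≤m (here refl)) (sum-map-≤ xs (f≤m ∘ there))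

  sum-map-zero : {f : A → ℕ} (xs : List A) → (∀ {x} → x ∈ xs → f x ≡ 0) → sum (map f xs) ≡ 0
  sum-map-zero []       f≡0 = refl
  sum-map-zero (x ∷ xs) f≡0 rewrite f≡0 (here refl) = sum-map-zero xs (f≡0 ∘ there)

  sum-map-single : {f : A → ℕ} {xs : List A} {y : A} → Unique xs → y ∈ xs →
                   (∀ {x} → x ∈ xs → x ≢ y → f x ≡ 0) → sum (map f xs) ≡ f y
  sum-map-single {f} {x ∷ xs} (x∉ ∷ _) (here refl) f≡0 =
    trans (cong (f x +_) (sum-map-zero xs λ z∈ → f≡0 (there z∈) λ { refl → All.lookup x∉ z∈ refl }))
          (+-identityʳ (f x))
  sum-map-single (x∉ ∷ xs!) (there y∈) f≡0
    rewrite f≡0 (here refl) (All.lookup x∉ y∈) = sum-map-single xs! y∈ (f≡0 ∘ there)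

  -- The first-moment principle in counting form; it replaces expectation when one colour is drawn
  -- from a block.
  ∃-≤-average : (f : A → ℕ) (m : ℕ) (xs : List A) → 1 ≤ length xs →
                sum (map f xs) ≤ length xs * m → ∃[ x ] (x ∈ xs × f x ≤ m)
  ∃-≤-average f m (x ∷ xs) _ Σ≤ with f x ≤? m
  ... | yes fx≤m = x , here refl , fx≤m
  ∃-≤-average f m (x ∷ []) _ Σ≤ | no fx≰m =
    contradiction (≤-trans (m≤m+n (f x) 0) (≤-trans Σ≤ (≤-reflexive (+-identityʳ m)))) fx≰m
  ∃-≤-average f m (x ∷ xs@(_ ∷ _)) _ Σ≤ | no fx≰m
    with ∃-≤-average f m xs (s≤s z≤n) (+-cancelˡ-≤ m _ _ (≤-trans (+-monoˡ-≤ _ (≰⇒≥ fx≰m)) Σ≤))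
  ... | y , y∈ , fy≤m = y , there y∈ , fy≤m

-- Sparse transversals by conditional expectations.

Edge : Set
Edge = ℕ × ℕ

-- With `w` equal to `k` times the selection probabilities, this is `k * k` times an upper bound on
-- the expected number of surviving edges: ends in different blocks are independent, and two
-- distinct ends in one block are never selected together.
potential : (ℕ → ℕ) → List Edge → ℕ
potential w es = sum (map (λ (x , y) → w x * w y) es)

potential-one : (es′ : List Edge) → potential (λ _ → 1) es′ ≡ length es′
potential-one []        = refl
potential-one (_ ∷ es′) = cong suc (potential-one es′)

inside? : (S : List ℕ) → Decidable (λ ((x , y) : Edge) → x ∈ S × y ∈ S)
inside? S (x , y) = (x ∈? S) ×-dec (y ∈? S)

module _ (k : ℕ) where

  -- The weights are k times the conditional probabilities that a colour is
  -- selected, when one colour of each block is drawn uniformly; `condition`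
  -- updates them once b has been drawn from the block B.
  condition : (ℕ → ℕ) → List ℕ → ℕ → ℕ → ℕ
  condition w B b x with x ≟ b | x ∈? B
  ... | yes _ | _     = k
  ... | no  _ | yes _ = 0
  ... | no  _ | no  _ = w x

  condition-chosen : ∀ w B b → condition w B b b ≡ k
  condition-chosen w B b with b ≟ b | b ∈? B
  ... | yes _ | _ = refl
  ... | no b≢b | _ = contradiction refl b≢b

  condition-rejected : ∀ w {B b x} → x ∈ B → x ≢ b → condition w B b x ≡ 0
  condition-rejected w {B} {b} {x} x∈B x≢b with x ≟ b | x ∈? B
  ... | yes x≡b | _      = contradiction x≡b x≢b
  ... | no  _   | yes _  = refl
  ... | no  _   | no x∉B = contradiction x∈B x∉B

  condition-other : ∀ w {B b x} → b ∈ B → x ∉ B → condition w B b x ≡ w x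
  condition-other w {B} {b} {x} b∈B x∉B with x ≟ b | x ∈? B
  ... | yes refl | _       = contradiction b∈B x∉B
  ... | no  _    | yes x∈B = contradiction x∈B x∉B
  ... | no  _    | no _    = refl

  condition-≢-≤ : ∀ w B {b x} → x ≢ b → condition w B b x ≤ w x
  condition-≢-≤ w B {b} {x} x≢b with x ≟ b | x ∈? B
  ... | yes x≡b | _     = contradiction x≡b x≢b
  ... | no  _   | yes _ = z≤n
  ... | no  _   | no  _ = ≤-refl

  module _ {w : ℕ → ℕ} {B : List ℕ} (B! : Unique B) (∣B∣≡k : length B ≡ k)
           (w≡1 : ∀ {x} → x ∈ B → w x ≡ 1) where

    -- If `x` lies in `B`, only the draw of `x` itself contributes: it lifts the weight of `x` from
    -- 1 to `k`, the length of `B`, and does not raise that of `y`, since `x ≢ y`. When `y` lies in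
    -- `B` too, the sum is even 0. Two ends outside `B` keep their weights.
    sum-condition-≤ : ∀ {x y} → x ≢ y →
      sum (map (λ b → condition w B b x * condition w B b y) B) ≤ length B * (w x * w y)
    sum-condition-≤ {x} {y} x≢y = cases (x ∈? B) (y ∈? B)
      where
      open ≤-Reasoning
      cases : Dec (x ∈ B) → Dec (y ∈ B) →
        sum (map (λ b → condition w B b x * condition w B b y) B) ≤ length B * (w x * w y)
      cases (yes x∈B) _ = begin
        sum (map (λ b → condition w B b x * condition w B b y) B)
          ≡⟨ sum-map-single B! x∈B (λ {b} _ b≢x → cong (_* condition w B b y) (condition-rejected w x∈B (b≢x ∘ sym))) ⟩
        condition w B x x * condition w B x y
          ≤⟨ *-mono-≤ (≤-reflexive (trans (condition-chosen w B x) (sym ∣B∣≡k))) (condition-≢-≤ w B (x≢y ∘ sym)) ⟩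
        length B * w y
          ≡⟨ cong (length B *_) (trans (cong (_* w y) (w≡1 x∈B)) (*-identityˡ (w y))) ⟨
        length B * (w x * w y) ∎
      cases (no _) (yes y∈B) = begin
        sum (map (λ b → condition w B b x * condition w B b y) B)
          ≡⟨ sum-map-single B! y∈B (λ {b} _ b≢y → trans (cong (condition w B b x *_) (condition-rejected w y∈B (b≢y ∘ sym))) (*-zeroʳ (condition w B b x))) ⟩
        condition w B y x * condition w B y y
          ≤⟨ *-mono-≤ (condition-≢-≤ w B x≢y) (≤-reflexive (trans (condition-chosen w B y) (sym ∣B∣≡k))) ⟩
        w x * length B
          ≡⟨ *-comm (w x) (length B) ⟩
        length B * w x
          ≡⟨ cong (length B *_) (trans (cong (w x *_) (w≡1 y∈B)) (*-identityʳ (w x))) ⟨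
        length B * (w x * w y) ∎
      cases (no x∉B) (no y∉B) = sum-map-≤ B λ b∈B →
        ≤-reflexive (cong₂ _*_ (condition-other w b∈B x∉B) (condition-other w b∈B y∉B))

    sum-potential-≤ : ∀ {es} → All (uncurry _≢_) es →
      sum (map (λ b → potential (condition w B b) es) B) ≤ length B * potential w es
    sum-potential-≤ []                           = ≤-trans (≤-reflexive (sum-map-zero B λ _ → refl)) z≤n
    sum-potential-≤ (_∷_ {x , y} {es} x≢y es≢) = begin
      sum (map (λ b → potential (condition w B b) ((x , y) ∷ es)) B)
        ≡⟨ sum-map-+ (λ b → condition w B b x * condition w B b y) (λ b → potential (condition w B b) es) B ⟩
      sum (map (λ b → condition w B b x * condition w B b y) B) + sum (map (λ b → potential (condition w B b) es) B)
        ≤⟨ +-mono-≤ (sum-condition-≤ x≢y) (sum-potential-≤ es≢) ⟩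
      length B * (w x * w y) + length B * potential w es
        ≡⟨ *-distribˡ-+ (length B) (w x * w y) (potential w es) ⟨
      length B * potential w ((x , y) ∷ es) ∎
      where open ≤-Reasoning

  -- An edge with both ends in `S` contributes exactly `k * k` to the potential; the others
  -- contribute at least 0.
  inside-≤-potential : ∀ {w S} → All (λ s → w s ≡ k) S → (es′ : List Edge) →
    k * k * length (filter (inside? S) es′) ≤ potential w es′
  inside-≤-potential w≡k [] = ≤-reflexive (*-zeroʳ (k * k))
  inside-≤-potential {w} {S} w≡k ((x , y) ∷ es′) = cases (inside? S (x , y))
    where
    open ≤-Reasoning
    cases : Dec (x ∈ S × y ∈ S) →
      k * k * length (filter (inside? S) ((x , y) ∷ es′)) ≤ potential w ((x , y) ∷ es′)
    cases (no xy∉S) rewrite filter-reject (inside? S) {xs = es′} xy∉S =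
      ≤-trans (inside-≤-potential w≡k es′) (m≤n+m _ _)
    cases (yes xy∈S@(x∈S , y∈S)) rewrite filter-accept (inside? S) {xs = es′} xy∈S = begin
      k * k * suc (length (filter (inside? S) es′))
        ≡⟨ *-suc (k * k) _ ⟩
      k * k + k * k * length (filter (inside? S) es′)
        ≤⟨ +-mono-≤ (≤-reflexive (sym (cong₂ _*_ (All.lookup w≡k x∈S) (All.lookup w≡k y∈S)))) (inside-≤-potential w≡k es′) ⟩
      w x * w y + potential w es′ ∎

  module _ (1≤k : 1 ≤ k) {es : List Edge} (es≢ : All (uncurry _≢_) es) where

    -- The method of conditional expectations: in each block some draw keeps the potential from
    -- rising above its average. The last conjunct preserves the weight `k` of a chosen colour while
    -- the later, disjoint blocks are treated.
    choose-by-potential : ∀ {Bs} → Unique (concat Bs) → All (λ B → length B ≡ k) Bs →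
      (w : ℕ → ℕ) → (∀ {x} → x ∈ concat Bs → w x ≡ 1) →
      ∃[ S ] ∃[ w′ ] (Pointwise _∈_ S Bs × potential w′ es ≤ potential w es ×
        All (λ s → w′ s ≡ k) S × (∀ {x} → x ∉ concat Bs → w′ x ≡ w x))
    choose-by-potential {[]} _ _ w _ = [] , w , [] , ≤-refl , [] , λ _ → refl
    choose-by-potential {B ∷ Bs} BBs! (∣B∣≡k ∷ sizes) w w≡1
      with Unique-++⁻ B BBs!
    ... | B! , Bs! , B#Bs
      with ∃-≤-average (λ b → potential (condition w B b) es) (potential w es) B
             (subst (1 ≤_) (sym ∣B∣≡k) 1≤k)
             (sum-potential-≤ B! ∣B∣≡k (w≡1 ∘ ∈-++⁺ˡ) es≢)
    ... | b , b∈B , Φb≤Φ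
      with choose-by-potential Bs! sizes (condition w B b)
             (λ x∈Bs → trans (condition-other w b∈B (λ x∈B → B#Bs (x∈B , x∈Bs))) (w≡1 (∈-++⁺ʳ B x∈Bs)))
    ... | S , w′ , S∈Bs , Φ′≤Φb , w′≡k , w′≡ =
      b ∷ S , w′ , b∈B ∷ S∈Bs , ≤-trans Φ′≤Φb Φb≤Φ ,
      trans (w′≡ (λ b∈Bs → B#Bs (b∈B , b∈Bs))) (condition-chosen w B b) ∷ w′≡k ,
      λ x∉ → trans (w′≡ (x∉ ∘ ∈-++⁺ʳ B)) (condition-other w b∈B (x∉ ∘ ∈-++⁺ˡ))

    -- With all weights 1 the potential starts at `length es`, and it never rises; in the end each
    -- surviving edge accounts for `k * k` of it.
    sparse-transversal : ∀ {Bs} → Unique (concat Bs) → All (λ B → length B ≡ k) Bs →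
      ∃[ S ] (Pointwise _∈_ S Bs × k * k * length (filter (inside? S) es) ≤ length es)
    sparse-transversal Bs! sizes with choose-by-potential Bs! sizes (λ _ → 1) (λ _ → refl)
    ... | S , w′ , S∈Bs , Φ≤ , w′≡k , _ = S , S∈Bs ,
      ≤-trans (inside-≤-potential w′≡k es) (≤-trans Φ≤ (≤-reflexive (potential-one es)))

transversal-∈ : ∀ {S Bs s} → Pointwise {A = ℕ} _∈_ S Bs → s ∈ S → s ∈ concat Bs
transversal-∈ (s∈B ∷ _)         (here refl) = ∈-++⁺ˡ s∈B
transversal-∈ (_∷_ {y = B} _ S∈Bs) (there s∈S) = ∈-++⁺ʳ B (transversal-∈ S∈Bs s∈S)

transversal-! : ∀ {S Bs} → Unique (concat Bs) → Pointwise {A = ℕ} _∈_ S Bs → Unique S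
transversal-! Bs! [] = []
transversal-! {Bs = B ∷ _} Bs! (s∈B ∷ S∈Bs) with Unique-++⁻ B Bs!
... | _ , Bs!′ , B#Bs = All.tabulate (λ { t∈S refl → B#Bs (s∈B , transversal-∈ S∈Bs t∈S) })
                        ∷ transversal-! Bs!′ S∈Bs

-- Blocks of colours lying in the same lists.

record Blocks (k : ℕ) {n : ℕ} (L : Fin n → List ℕ) (U : List ℕ) : Set where
  field
    blocks      : List (List ℕ)
    rest        : List ℕ
    perm        : U ↭ concat blocks ++ rest
    sizes       : All (λ B → length B ≡ k) blocks
    homogeneous : All (λ B → ∀ i → All (_∈ L i) B ⊎ All (_∉ L i) B) blocks
    ∣rest∣≤     : length rest ≤ 2 ^ n * k

chop : ∀ k → 1 ≤ k → (U : List ℕ) → ∃[ Bs ] ∃[ R ] (U ↭ concat Bs ++ R ×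
         All (λ B → length B ≡ k) Bs × length R < k)
chop k 1≤k []      = [] , [] , ↭-refl , [] , 1≤k
chop k 1≤k (x ∷ U) with chop k 1≤k U
... | Bs , R , U↭ , sizes , ∣R∣<k with suc (length R) ≟ k
...   | yes ∣xR∣≡k = (x ∷ R) ∷ Bs , [] , prep x (begin
        U                       ↭⟨ U↭ ⟩
        concat Bs ++ R          ↭⟨ ↭-++-comm (concat Bs) R ⟩
        R ++ concat Bs          ≡⟨ ++-identityʳ _ ⟨
        (R ++ concat Bs) ++ []  ∎) , ∣xR∣≡k ∷ sizes , 1≤k
        where open PermutationReasoning
...   | no ∣xR∣≢k = Bs , x ∷ R , ↭-trans (prep x U↭) (↭-sym (shift x (concat Bs) R)) ,
        sizes , ≤∧≢⇒< ∣R∣<k ∣xR∣≢k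

-- Membership is decided one list at a time, so the recursion has `2 ^ n` leaves, one for each type
-- of colour. Each leaf is chopped separately and leaves a rest shorter than `k`.
split : ∀ k → 1 ≤ k → ∀ {n} (L : Fin n → List ℕ) (U : List ℕ) → Blocks k L U
split k 1≤k {zero} L U with chop k 1≤k U
... | Bs , R , U↭ , sizes , ∣R∣<k = record
  { blocks = Bs ; rest = R ; perm = U↭ ; sizes = sizes
  ; homogeneous = All.map (λ _ ()) sizes
  ; ∣rest∣≤ = ≤-trans (<⇒≤ ∣R∣<k) (≤-reflexive (sym (+-identityʳ k))) }
split k 1≤k {suc n} L U = record
  { blocks = Y.blocks ++ Z.blocks
  ; rest   = Y.rest ++ Z.rest
  ; perm   = begin
      U                                                                ↭⟨ ↭ₛ⇒↭ (Permₛ.partition-↭ (setoid ℕ) (_∈? L zero) U) ⟩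
      ys ++ zs                                                         ↭⟨ ↭-++⁺ Y.perm Z.perm ⟩
      (concat Y.blocks ++ Y.rest) ++ (concat Z.blocks ++ Z.rest)       ↭⟨ ++-interchange-↭ (concat Y.blocks) Y.rest (concat Z.blocks) Z.rest ⟩
      (concat Y.blocks ++ concat Z.blocks) ++ (Y.rest ++ Z.rest)       ≡⟨ cong (_++ Y.rest ++ Z.rest) (concat-++ Y.blocks Z.blocks) ⟩
      concat (Y.blocks ++ Z.blocks) ++ (Y.rest ++ Z.rest)              ∎
  ; sizes  = Allₚ.++⁺ Y.sizes Z.sizes
  ; homogeneous = Allₚ.++⁺
      (All.zipWith (λ { (B∈ , h) zero → inj₁ B∈ ; (B∈ , h) (suc i) → h i }) (blocks-of ys↦ Y.perm , Y.homogeneous))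
      (All.zipWith (λ { (B∉ , h) zero → inj₂ B∉ ; (B∉ , h) (suc i) → h i }) (blocks-of zs↦ Z.perm , Z.homogeneous))
  ; ∣rest∣≤ = ≤-trans (≤-reflexive (length-++ Y.rest)) (≤-trans (+-mono-≤ Y.∣rest∣≤ Z.∣rest∣≤)
      (≤-reflexive (trans (sym (*-distribʳ-+ k (2 ^ n) (2 ^ n))) (cong (λ m → (2 ^ n + m) * k) (sym (+-identityʳ (2 ^ n)))))))
  }
  where
  open PermutationReasoning
  ys = proj₁ (partition (_∈? L zero) U)
  zs = proj₂ (partition (_∈? L zero) U)
  ys↦ = proj₁ (Allₚ.partition-All (_∈? L zero) U)
  zs↦ = proj₂ (Allₚ.partition-All (_∈? L zero) U)
  module Y = Blocks (split k 1≤k (L ∘ suc) ys)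
  module Z = Blocks (split k 1≤k (L ∘ suc) zs)
  blocks-of : ∀ {P : ℕ → Set} {V Bs R} → All P V → V ↭ concat Bs ++ R → All (All P) Bs
  blocks-of {Bs = Bs} all V↭ = Allₚ.concat⁻ (Allₚ.++⁻ˡ (concat Bs) (All-resp-↭ V↭ all))

-- By homogeneity the representative in `S` decides for its whole block, which therefore counts
-- either `k` or 0.
length-filter-blocks : ∀ {k} {P : ℕ → Set} (P? : Decidable P) {S Bs} → Pointwise _∈_ S Bs →
  All (λ B → length B ≡ k) Bs → All (λ B → All P B ⊎ All (¬_ ∘ P) B) Bs →
  length (filter P? (concat Bs)) ≤ k * length (filter P? S)
length-filter-blocks P? [] [] [] = z≤n
length-filter-blocks {k} P? (_∷_ {s} {B} {S} {Bs} s∈B S∈Bs) (refl ∷ sizes) (inj₁ allP ∷ hom)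
  rewrite filter-++ P? B (concat Bs) | filter-accept P? {xs = S} (All.lookup allP s∈B) = begin
    length (filter P? B ++ filter P? (concat Bs))        ≡⟨ length-++ (filter P? B) ⟩
    length (filter P? B) + length (filter P? (concat Bs)) ≤⟨ +-mono-≤ (length-filter P? B) (length-filter-blocks P? S∈Bs sizes hom) ⟩
    k + k * length (filter P? S)                          ≡⟨ *-suc k _ ⟨
    k * suc (length (filter P? S))                        ∎
  where open ≤-Reasoning
length-filter-blocks P? (_∷_ {s} {B} {S} {Bs} s∈B S∈Bs) (refl ∷ sizes) (inj₂ none ∷ hom)
  rewrite filter-++ P? B (concat Bs) | filter-none P? none | filter-reject P? {xs = S} (All.lookup none s∈B) =
    length-filter-blocks P? S∈Bs sizes hom

-- Colourings that beat every graph with `q` edges; thinning the lists.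

Avoids : {a : ℕ} → (Fin a → ℕ) → Edge → Set
Avoids c (x , y) = (∀ i → c i ≢ x) ⊎ (∀ i → c i ≢ y)

-- Lists may exceed `g` and edges may be fewer than `q`, because thinning controls both only by
-- inequalities. Loops are excluded since the two colours in a list differ.
Colorable : {a : ℕ} → (Fin a → ℕ) → ℕ → Set
Colorable {a} g q = (L : Fin a → List ℕ) → (∀ i → Unique (L i)) → (∀ i → g i ≤ length (L i)) →
  (es : List Edge) → All (uncurry _≢_) es → length es ≤ q →
  ∃[ c ] ((∀ i → c i ∈ L i) × All (Avoids c) es)

-- Restricting the lists to a sparse transversal divides their sizes by about `k` and the number of
-- edges by `k * k`. The summand `2 ^ a` pays for the colours left out of all blocks.
Colorable-expand : ∀ {a} {g : Fin a → ℕ} {q} k → 1 ≤ k → Colorable g q →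
  Colorable (λ i → k * (g i + 2 ^ a)) (k * k * q)
Colorable-expand {a} {g} {q} k@(suc _) 1≤k colorable L L! g≤ es es≢ ∣es∣≤ =
  c , (λ i → proj₂ (c∈ i)) , All.tabulate avoids
  where
  U : List ℕ
  U = deduplicate _≟_ (concat (tabulate L))

  open Blocks (split k 1≤k L U)

  blocks! : Unique (concat blocks)
  blocks! = proj₁ (Unique-++⁻ (concat blocks) (Unique-resp-↭ perm (deduplicate-! _≟_ (concat (tabulate L)))))

  transversal = sparse-transversal k 1≤k es≢ blocks! sizes
  S = proj₁ transversal
  S∈blocks = proj₁ (proj₂ transversal)

  L′ : Fin a → List ℕ
  L′ i = filter (_∈? L i) S

  g≤′ : ∀ i → g i ≤ length (L′ i)
  -- The leftover colours cost each list at most `2 ^ a * k`, exactly the surplus granted by the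
  -- hypothesis; then a factor `k` cancels.
  g≤′ i = *-cancelˡ-≤ k (+-cancelʳ-≤ (k * 2 ^ a) _ _ (begin
    k * g i + k * 2 ^ a                                           ≡⟨ *-distribˡ-+ k (g i) (2 ^ a) ⟨
    k * (g i + 2 ^ a)                                             ≤⟨ g≤ i ⟩
    length (L i)                                                  ≤⟨ Unique-⊆⇒length-≤ (L! i) (λ x∈ → ∈-filter⁺ (_∈? L i) (∈-deduplicate⁺ _≟_ (∈-concat⁺′ x∈ (∈-tabulate⁺ i))) x∈) ⟩
    length (filter (_∈? L i) U)                                   ≡⟨ ↭-length (filter-↭ (_∈? L i) perm) ⟩
    length (filter (_∈? L i) (concat blocks ++ rest))             ≡⟨ cong length (filter-++ (_∈? L i) (concat blocks) rest) ⟩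
    length (filter (_∈? L i) (concat blocks) ++ filter (_∈? L i) rest) ≡⟨ length-++ (filter (_∈? L i) (concat blocks)) ⟩
    length (filter (_∈? L i) (concat blocks)) + length (filter (_∈? L i) rest)
      ≤⟨ +-mono-≤ (length-filter-blocks (_∈? L i) S∈blocks sizes (All.map (λ h → h i) homogeneous))
                  (≤-trans (length-filter (_∈? L i) rest) ∣rest∣≤) ⟩
    k * length (L′ i) + 2 ^ a * k                                 ≡⟨ cong (k * length (L′ i) +_) (*-comm (2 ^ a) k) ⟩
    k * length (L′ i) + k * 2 ^ a                                 ∎))
    where open ≤-Reasoning

  coloring = colorable L′ (λ i → Uniqueₚ.filter⁺ (_∈? L i) (transversal-! blocks! S∈blocks)) g≤′
    (filter (inside? S) es) (Allₚ.filter⁺ (inside? S) es≢)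
    (*-cancelˡ-≤ (k * k) (≤-trans (proj₂ (proj₂ transversal)) ∣es∣≤))
  c = proj₁ coloring

  c∈ : ∀ i → c i ∈ S × c i ∈ L i
  c∈ i = ∈-filter⁻ (_∈? L i) (proj₁ (proj₂ coloring) i)

  avoids : ∀ {e} → e ∈ es → Avoids c e
  -- An edge not inside `S` is avoided at once, because every colour used lies in `S`.
  avoids {x , y} e∈ with x ∈? S | y ∈? S
  ... | no x∉S  | _       = inj₁ λ { i refl → x∉S (proj₁ (c∈ i)) }
  ... | yes _   | no y∉S  = inj₂ λ { i refl → y∉S (proj₁ (c∈ i)) }
  ... | yes x∈S | yes y∈S = All.lookup (proj₂ (proj₂ coloring)) (∈-filter⁺ (inside? S) e∈ (x∈S , y∈S))

-- Blowing up colours into clones.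

length-cartesianProductWith : ∀ {A B C : Set} (f : A → B → C) xs ys →
  length (cartesianProductWith f xs ys) ≡ length xs * length ys
length-cartesianProductWith f []       ys = refl
length-cartesianProductWith f (x ∷ xs) ys = begin
  length (map (f x) ys ++ cartesianProductWith f xs ys)         ≡⟨ length-++ (map (f x) ys) ⟩
  length (map (f x) ys) + length (cartesianProductWith f xs ys) ≡⟨ cong₂ _+_ (length-map (f x) ys) (length-cartesianProductWith f xs ys) ⟩
  length ys + length xs * length ys                             ∎
  where open ≡-Reasoning

module Clones (k : ℕ) .{{_ : NonZero k}} where

  -- Clones occupy consecutive runs of length `k`, so that division by `k` recovers the original
  -- colour.
  clone : ℕ → Fin k → ℕ
  clone x t = x * k + toℕ t

  clone-/ : ∀ x t → clone x t / k ≡ x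
  clone-/ x t = begin
    (x * k + toℕ t) / k      ≡⟨ +-distrib-/-∣ˡ {x * k} (toℕ t) {k} (n∣m*n x) ⟩
    x * k / k + toℕ t / k    ≡⟨ cong₂ _+_ (m*n/n≡m x k) (m<n⇒m/n≡0 (toℕ<n t)) ⟩
    x + 0                    ≡⟨ +-identityʳ x ⟩
    x                        ∎
    where open ≡-Reasoning

  clone-injective : ∀ {x y t u} → clone x t ≡ clone y u → x ≡ y × t ≡ u
  clone-injective {x} {y} {t} {u} eq with trans (sym (clone-/ x t)) (trans (cong (_/ k) eq) (clone-/ y u))
  ... | refl = refl , toℕ-injective (+-cancelˡ-≡ (x * k) (toℕ t) (toℕ u) eq)

  cloneEdge : Edge → Fin k × Fin k → Edge
  cloneEdge (x , y) (t , u) = clone x t , clone y u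

  cloneList : List ℕ → List ℕ
  cloneList xs = cartesianProductWith clone xs (allFin k)

  length-allFin : length (allFin k) ≡ k
  length-allFin = length-tabulate {n = k} id

  cloneList-! : ∀ {xs} → Unique xs → Unique (cloneList xs)
  cloneList-! xs! = Uniqueₚ.cartesianProductWith⁺ clone clone-injective xs! (Uniqueₚ.allFin⁺ k)

  length-cloneList : ∀ xs → length (cloneList xs) ≡ length xs * k
  length-cloneList xs = trans (length-cartesianProductWith clone xs (allFin k)) (cong (length xs *_) length-allFin)

  cloneEdges : List Edge → List Edge
  cloneEdges es = cartesianProductWith cloneEdge es (cartesianProduct (allFin k) (allFin k))

  length-cloneEdges : ∀ es → length (cloneEdges es) ≡ length es * (k * k)
  length-cloneEdges es = trans (length-cartesianProductWith cloneEdge es (cartesianProduct (allFin k) (allFin k)))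
    (cong (length es *_) (trans (length-cartesianProductWith _,_ (allFin k) (allFin k)) (cong₂ _*_ length-allFin length-allFin)))

  -- Every colour becomes `k` clones and every edge all `k * k` edges between clones of its ends;
  -- dividing by `k` brings a colouring of the blow-up back to the original lists.
  Colorable-shrink : ∀ {a} {f g : Fin a → ℕ} {q} → (∀ i → f i ≤ g i * k) →
    Colorable f (q * (k * k)) → Colorable g q
  Colorable-shrink {a} {f} {g} {q} f≤ colorable L L! g≤ es es≢ ∣es∣≤ =
    (λ i → c i / k) , (λ i → proj₁ (origin i)) , All.tabulate avoids
    where
    coloring = colorable (cloneList ∘ L) (cloneList-! ∘ L!)
      (λ i → ≤-trans (f≤ i) (≤-trans (*-monoˡ-≤ k (g≤ i)) (≤-reflexive (sym (length-cloneList (L i))))))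
      (cloneEdges es)
      (Allₚ.cartesianProductWith⁺ (setoid _) (setoid _) cloneEdge es (cartesianProduct (allFin k) (allFin k))
        (λ e∈ _ eq → All.lookup es≢ e∈ (proj₁ (clone-injective eq))))
      (≤-trans (≤-reflexive (length-cloneEdges es)) (*-monoˡ-≤ (k * k) ∣es∣≤))
    c = proj₁ coloring

    origin : ∀ i → c i / k ∈ L i × ∃[ t ] c i ≡ clone (c i / k) t
    origin i with ∈-cartesianProductWith⁻ clone (L i) (allFin k) (proj₁ (proj₂ coloring) i)
    ... | x , t , x∈ , _ , c≡ = subst (λ y → y ∈ L i × ∃[ t ] c i ≡ clone y t)
      (sym (trans (cong (_/ k) c≡) (clone-/ x t))) (x∈ , t , c≡)

    avoids : ∀ {e} → e ∈ es → Avoids (λ i → c i / k) e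
    avoids {x , y} e∈ with any? (λ i → c i / k ≟ x) | any? (λ i → c i / k ≟ y)
    ... | no ¬x       | _           = inj₁ λ i eq → ¬x (i , eq)
    ... | yes _       | no ¬y       = inj₂ λ i eq → ¬y (i , eq)
    -- If both ends were in use, through clones `t` and `u`, the edge joining these two clones would
    -- not be avoided.
    ... | yes (i , refl) | yes (j , refl)
      with origin i | origin j
    ... | _ , t , ci≡ | _ , u , cj≡ =
      [ (λ ≢x → contradiction ci≡ (≢x i)) , (λ ≢y → contradiction cj≡ (≢y j)) ]′
        (All.lookup (proj₂ (proj₂ coloring))
          (∈-cartesianProductWith⁺ cloneEdge e∈ (∈-cartesianProduct⁺ (∈-allFin t) (∈-allFin u))))

-- From graphs on the colours to list assignments and back.

Colorable-mono : ∀ {a} {g : Fin a → ℕ} {q r} → q ≤ r → Colorable g r → Colorable g q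
Colorable-mono q≤r colorable L L! g≤ es es≢ ∣es∣≤ = colorable L L! g≤ es es≢ (≤-trans ∣es∣≤ q≤r)

∈-take : ∀ {A : Set} {x : A} n xs → x ∈ take n xs → x ∈ xs
∈-take (suc n) (x ∷ xs) (here refl) = here refl
∈-take (suc n) (x ∷ xs) (there x∈)  = there (∈-take n xs x∈)

typeII : ∀ {a} → (Fin a → ℕ) → (q : ℕ) → KV a q → ℕ
typeII g q = [ g , (λ _ → 2) ]′

Colorable⇒Choosable : ∀ {a q} {g : Fin a → ℕ} → Colorable g q → Choosable KAdj (typeII g q)
Colorable⇒Choosable {a} {q} {g} colorable L assigned = color , color∈ , proper
  where
  record Pair (xs : List ℕ) : Set where
    constructor pair
    field
      edge    : Edge
      edge-≢  : uncurry _≢_ edge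
      fst∈    : proj₁ edge ∈ xs
      snd∈    : proj₂ edge ∈ xs

  toPair : ∀ {xs} → Unique xs × length xs ≡ 2 → Pair xs
  toPair {x ∷ y ∷ []} ((x≢y ∷ []) ∷ _ , refl) = pair (x , y) x≢y (here refl) (there (here refl))

  P : (j : Fin q) → Pair (L (inj₂ j))
  P j = toPair (assigned (inj₂ j))

  coloring = colorable (L ∘ inj₁) (λ i → proj₁ (assigned (inj₁ i))) (λ i → ≤-reflexive (sym (proj₂ (assigned (inj₁ i)))))
    (tabulate (Pair.edge ∘ P)) (Allₚ.tabulate⁺ (Pair.edge-≢ ∘ P)) (≤-reflexive (length-tabulate (Pair.edge ∘ P)))
  c = proj₁ coloring

  free : (j : Fin q) → ∃[ x ] (x ∈ L (inj₂ j) × ∀ i → c i ≢ x)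
  free j = [ (λ ≢x → _ , Pair.fst∈ (P j) , ≢x) , (λ ≢y → _ , Pair.snd∈ (P j) , ≢y) ]′
    (Allₚ.tabulate⁻ (proj₂ (proj₂ coloring)) j)

  color : KV a q → ℕ
  color = [ c , proj₁ ∘ free ]′

  color∈ : ∀ v → color v ∈ L v
  color∈ (inj₁ i) = proj₁ (proj₂ coloring) i
  color∈ (inj₂ j) = proj₁ (proj₂ (free j))

  proper : ∀ u v → KAdj u v → color u ≢ color v
  proper _ _ (aq i j) = proj₂ (proj₂ (free j)) i
  proper _ _ (qa i j) = proj₂ (proj₂ (free j)) i ∘ sym

-- `Choosable` covers only lists of exact size, so longer lists on A are truncated first. The colour
-- given to a vertex of Q is then an end of its edge that A does not use.
Choosable⇒Colorable : ∀ {a q} {f : KV a q → ℕ} → TypeII f → Choosable KAdj f → Colorable (f ∘ inj₁) q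
Choosable⇒Colorable {a} {q} {f} f≡2 choosable L L! f≤ es es≢ ∣es∣≤q =
  c ∘ inj₁ , (λ i → ∈-take (f (inj₁ i)) (L i) (c∈ (inj₁ i))) , All.tabulate avoids
  where
  -- Padding to exactly q edges is harmless: extra edges only constrain c further.
  es⁺ : List Edge
  es⁺ = es ++ replicate (q ∸ length es) (0 , 1)

  ∣es⁺∣ : q ≡ length es⁺
  ∣es⁺∣ = sym (trans (length-++ es) (trans (cong (length es +_) (length-replicate (q ∸ length es))) (m+[n∸m]≡n ∣es∣≤q)))

  es⁺≢ : All (uncurry _≢_) es⁺
  es⁺≢ = Allₚ.++⁺ es≢ (Allₚ.replicate⁺ (q ∸ length es) λ ())

  edge : Fin q → Edge
  edge j = lookup es⁺ (cast ∣es⁺∣ j)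

  L⁺ : KV a q → List ℕ
  L⁺ (inj₁ i) = take (f (inj₁ i)) (L i)
  L⁺ (inj₂ j) = proj₁ (edge j) ∷ proj₂ (edge j) ∷ []

  assigned : IsAssignment f L⁺
  assigned (inj₁ i) = Uniqueₚ.take⁺ (f (inj₁ i)) (L! i) , trans (length-take (f (inj₁ i)) (L i)) (m≤n⇒m⊓n≡m (f≤ i))
  assigned (inj₂ j) = ((All.lookup es⁺≢ (∈-lookup (cast ∣es⁺∣ j)) ∷ []) ∷ [] ∷ []) , sym (f≡2 j)

  coloring = choosable L⁺ assigned
  c = proj₁ coloring
  c∈ = proj₁ (proj₂ coloring)

  avoids-edge : ∀ j → Avoids (c ∘ inj₁) (edge j)
  avoids-edge j with c∈ (inj₂ j)
  ... | here c≡x         = inj₁ λ i ci≡x → proj₂ (proj₂ coloring) _ _ (aq i j) (trans ci≡x (sym c≡x))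
  ... | there (here c≡y) = inj₂ λ i ci≡y → proj₂ (proj₂ coloring) _ _ (aq i j) (trans ci≡y (sym c≡y))

  avoids : ∀ {e} → e ∈ es → Avoids (c ∘ inj₁) e
  avoids e∈ = subst (Avoids (c ∘ inj₁)) (sym e≡) (avoids-edge (cast (sym ∣es⁺∣) (index e∈⁺)))
    where
    e∈⁺ = ∈-++⁺ˡ e∈
    e≡ = trans (lookup-index e∈⁺) (cong (lookup es⁺)
      (toℕ-injective (sym (trans (toℕ-cast ∣es⁺∣ _) (toℕ-cast (sym ∣es⁺∣) (index e∈⁺))))))

-- Weights and the two bounds on the excess.

total : ∀ {a} → (Fin a → ℕ) → ℕ
total {a} g = sum (map g (allFin a))

sum-map-const : ∀ {A : Set} m (xs : List A) → sum (map (λ _ → m) xs) ≡ length xs * m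
sum-map-const m []       = refl
sum-map-const m (x ∷ xs) = cong (m +_) (sum-map-const m xs)

weight-typeII : ∀ {a q} {f : KV a q → ℕ} → TypeII f → weight f ≡ total (f ∘ inj₁) + 2 * q
weight-typeII {a} {q} {f} f≡2 = cong (total (f ∘ inj₁) +_) (begin
  sum (map (f ∘ inj₂) (allFin q))  ≡⟨ cong sum (map-cong f≡2 (allFin q)) ⟩
  sum (map (λ _ → 2) (allFin q))   ≡⟨ sum-map-const 2 (allFin q) ⟩
  length (allFin q) * 2            ≡⟨ cong (_* 2) (length-tabulate {n = q} id) ⟩
  q * 2                            ≡⟨ *-comm q 2 ⟩
  2 * q                            ∎)
  where open ≡-Reasoning

total-*-+ : ∀ {a} k m (g : Fin a → ℕ) → total (λ i → k * (g i + m)) ≡ k * (total g + a * m)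
total-*-+ {a} k m g = trans (lemma (allFin a)) (cong (λ n → k * (total g + n * m)) (length-tabulate {n = a} id))
  where
  open ≡-Reasoning
  lemma : ∀ is → sum (map (λ i → k * (g i + m)) is) ≡ k * (sum (map g is) + length is * m)
  lemma []       = sym (*-zeroʳ k)
  lemma (i ∷ is) = begin
    k * (g i + m) + sum (map (λ i → k * (g i + m)) is)   ≡⟨ cong (k * (g i + m) +_) (lemma is) ⟩
    k * (g i + m) + k * (sum (map g is) + length is * m) ≡⟨ *-distribˡ-+ k (g i + m) _ ⟨
    k * (g i + m + (sum (map g is) + length is * m))     ≡⟨ cong (k *_) (+-interchange (g i) m _ _) ⟩
    k * (g i + sum (map g is) + (m + length is * m))     ∎

-- Rounding up by `suc` costs at most `k` per vertex after multiplying back; this is the error term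
-- `k * a` of the lower bound.
total-suc-/ : ∀ {a} k .{{_ : NonZero k}} (f : Fin a → ℕ) →
  k * total (λ i → suc (f i / k)) ≤ total f + k * a
total-suc-/ {a} k f = ≤-trans (lemma (allFin a)) (≤-reflexive (cong (λ n → total f + k * n) (length-tabulate {n = a} id)))
  where
  open ≤-Reasoning
  lemma : ∀ is → k * sum (map (λ i → suc (f i / k)) is) ≤ sum (map f is) + k * length is
  lemma []       = m≤n+m (k * 0) 0
  lemma (i ∷ is) = begin
    k * (suc (f i / k) + sum (map (λ i → suc (f i / k)) is))      ≡⟨ *-distribˡ-+ k (suc (f i / k)) _ ⟩
    k * suc (f i / k) + k * sum (map (λ i → suc (f i / k)) is)    ≤⟨ +-mono-≤ k*≤ (lemma is) ⟩
    (f i + k) + (sum (map f is) + k * length is)                  ≡⟨ +-interchange (f i) k _ _ ⟩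
    (f i + sum (map f is)) + (k + k * length is)                  ≡⟨ cong (f i + sum (map f is) +_) (*-suc k (length is)) ⟨
    f i + sum (map f is) + k * suc (length is)                    ∎
    where
    k*≤ : k * suc (f i / k) ≤ f i + k
    k*≤ = ≤-trans (≤-reflexive (trans (*-suc k (f i / k)) (trans (+-comm k _) (cong (_+ k) (*-comm k (f i / k))))))
      (+-monoˡ-≤ k (m/n*n≤m (f i) k))

module _ {a : ℕ} {χ : ℕ → ℕ} (isχ : ∀ q → IsChiSc2 a q (χ q)) where

  -- The truncated subtraction is exact, because the lists on Q alone contribute `2 * q` to every
  -- type II weight.
  excess : ℕ → ℕ
  excess q = χ q ∸ 2 * q

  excess-attained : ∀ q → ∃[ g ] (Colorable {a} g q × total g ≡ excess q)
  excess-attained q with proj₁ (isχ q)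
  ... | f , f≡2 , choosable , weight≡ = f ∘ inj₁ , Choosable⇒Colorable f≡2 choosable ,
    sym (trans (cong (_∸ 2 * q) (trans (sym weight≡) (weight-typeII {f = f} f≡2))) (m+n∸n≡m _ (2 * q)))

  excess-minimal : ∀ {q} {g : Fin a → ℕ} → Colorable g q → excess q ≤ total g
  excess-minimal {q} {g} colorable = begin
    χ q ∸ 2 * q                   ≤⟨ ∸-monoˡ-≤ (2 * q) (proj₂ (isχ q) (typeII g q) (λ _ → refl) (Colorable⇒Choosable colorable)) ⟩
    weight (typeII g q) ∸ 2 * q   ≡⟨ cong (_∸ 2 * q) (weight-typeII {f = typeII g q} (λ _ → refl)) ⟩
    (total g + 2 * q) ∸ 2 * q     ≡⟨ m+n∸n≡m _ (2 * q) ⟩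
    total g                       ∎
    where open ≤-Reasoning

  -- An optimal `g` for `q` edges expands to list sizes that beat `k * k * q` edges, hence also `r`
  -- edges.
  excess-upper : ∀ k q r → 1 ≤ k → r ≤ k * k * q → excess r ≤ k * (excess q + a * 2 ^ a)
  excess-upper k q r 1≤k r≤ with excess-attained q
  ... | g , colorable , total≡ = begin
    excess r                           ≤⟨ excess-minimal (Colorable-mono r≤ (Colorable-expand k 1≤k colorable)) ⟩
    total (λ i → k * (g i + 2 ^ a))    ≡⟨ total-*-+ k (2 ^ a) g ⟩
    k * (total g + a * 2 ^ a)          ≡⟨ cong (λ n → k * (n + a * 2 ^ a)) total≡ ⟩
    k * (excess q + a * 2 ^ a)         ∎
    where open ≤-Reasoning

  -- An optimal `f` for `r` edges, divided by `k` and rounded up, beats `q` edges by cloning.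
  excess-lower : ∀ k q r → 1 ≤ k → k * k * q ≤ r → k * excess q ≤ excess r + k * a
  excess-lower k@(suc _) q r 1≤k ≤r with excess-attained r
  ... | f , colorable , total≡ = begin
    k * excess q                    ≤⟨ *-monoʳ-≤ k (excess-minimal {q} (Clones.Colorable-shrink k f≤ (Colorable-mono (≤-trans (≤-reflexive (*-comm q (k * k))) ≤r) colorable))) ⟩
    k * total (λ i → suc (f i / k)) ≤⟨ total-suc-/ k f ⟩
    total f + k * a                 ≡⟨ cong (_+ k * a) total≡ ⟩
    excess r + k * a                ∎
    where
    open ≤-Reasoning
    f≤ : ∀ i → f i ≤ suc (f i / k) * k
    f≤ i = ≤-trans (≤-reflexive (m≡m%n+[m/n]*n (f i) k)) (+-monoˡ-≤ (f i / k * k) (<⇒≤ (m%n<n (f i) k)))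

-- Squeezing d(q)/√q for large q.

-- Here `k` is the integer part of √q / p. It grows by at most 1 when `q` does, so induction on `q`
-- suffices.
sqrt-multiple : ∀ p → 1 ≤ p → ∀ q → ∃[ k ] ((k * p) * (k * p) ≤ q × q < (suc k * p) * (suc k * p))
sqrt-multiple p 1≤p zero    = 0 , z≤n , *-mono-< (0<* 0) (0<* 0)
  where
  0<* : ∀ k → 0 < suc k * p
  0<* k = ≤-trans 1≤p (m≤m+n p (k * p))
sqrt-multiple p 1≤p (suc q) with sqrt-multiple p 1≤p q
... | k , k≤ , <k with suc q <? (suc k * p) * (suc k * p)
...   | yes lt = k , m≤n⇒m≤1+n k≤ , lt
...   | no  ge = suc k , ≮⇒≥ ge , ≤-<-trans <k (*-mono-< step step)
  where
  step : suc k * p < suc (suc k) * p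
  step = m<n+m (suc k * p) 1≤p

module _ {d : ℕ → ℕ} {C : ℕ}
  (lower : ∀ k q r → 1 ≤ k → k * k * q ≤ r → k * d q ≤ d r + k * C)
  (upper : ∀ k q r → 1 ≤ k → r ≤ k * k * q → d r ≤ k * (d q + C)) where

  module _ (p : ℕ) (1≤p : 1 ≤ p) where

    private
      D = d (p * p)
      s = D ∸ suc C
      t = D + suc C

    -- For `k` the integer part of √q / p, `lower` is applied with `k` and `upper` with `suc k`. The
    -- extra 1 in `suc C` absorbs the change between `k` and `suc k`; this needs `t ≤ k`, which is
    -- what the threshold on `q` secures.
    squeeze : ∀ q → (t * p) * (t * p) ≤ q →
      s * s * q ≤ d q * d q * (p * p) × d q * d q * (p * p) ≤ t * t * q
    squeeze q N≤q with sqrt-multiple p 1≤p q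
    ... | k , kp≤q , q<kp = low , high
      where
      open ≤-Reasoning
      open +-*-Solver

      t≤k : t ≤ k
      t≤k with t ≤? k
      ... | yes t≤k = t≤k
      ... | no  t≰k = contradiction (≤-trans (*-mono-≤ le le) N≤q) (<⇒≱ q<kp)
        where
        le = *-monoˡ-≤ p (≰⇒> t≰k)

      1≤k : 1 ≤ k
      1≤k = ≤-trans (≤-trans (s≤s z≤n) (m≤n+m (suc C) D)) t≤k

      s≤k : s ≤ k
      s≤k = ≤-trans (m∸n≤m D (suc C)) (≤-trans (m≤m+n D (suc C)) t≤k)

      s-bound : suc k * s ≤ d q
      s-bound with suc C ≤? D
      -- For `D` below `suc C` the truncated `s` is 0 and the bound is trivial.
      ... | no C≰D = ≤-trans (≤-reflexive (trans (cong (suc k *_) (m≤n⇒m∸n≡0 (<⇒≤ (≰⇒> C≰D)))) (*-zeroʳ (suc k)))) z≤n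
      ... | yes C≤D = +-cancelʳ-≤ (k * C) _ _ (begin
        suc k * s + k * C    ≤⟨ +-monoˡ-≤ (k * C) (+-monoˡ-≤ (k * s) s≤k) ⟩
        k + k * s + k * C    ≡⟨ solve 3 (λ k s C → k :+ k :* s :+ k :* C := k :* (s :+ (con 1 :+ C))) refl k s C ⟩
        k * (s + suc C)      ≡⟨ cong (k *_) (m∸n+n≡m C≤D) ⟩
        k * D                ≤⟨ lower k (p * p) q 1≤k (≤-trans (≤-reflexive (solve 2 (λ k p → k :* k :* (p :* p) := k :* p :* (k :* p)) refl k p)) kp≤q) ⟩
        d q + k * C          ∎)

      t-bound : d q ≤ k * t
      t-bound = begin
        d q                       ≤⟨ upper (suc k) (p * p) q (s≤s z≤n) (≤-trans (<⇒≤ q<kp) (≤-reflexive (solve 2 (λ k p → (k :* p) :* (k :* p) := k :* k :* (p :* p)) refl (suc k) p))) ⟩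
        suc k * (D + C)           ≤⟨ +-monoˡ-≤ (k * (D + C)) (≤-trans (+-monoʳ-≤ D (n≤1+n C)) t≤k) ⟩
        k + k * (D + C)           ≡⟨ solve 3 (λ k D C → k :+ k :* (D :+ C) := k :* (D :+ (con 1 :+ C))) refl k D C ⟩
        k * t                     ∎

      low : s * s * q ≤ d q * d q * (p * p)
      low = begin
        s * s * q                              ≤⟨ *-monoʳ-≤ (s * s) (<⇒≤ q<kp) ⟩
        s * s * (suc k * p * (suc k * p))      ≡⟨ solve 3 (λ s k p → s :* s :* (k :* p :* (k :* p)) := (k :* s) :* (k :* s) :* (p :* p)) refl s (suc k) p ⟩
        (suc k * s) * (suc k * s) * (p * p)    ≤⟨ *-monoˡ-≤ (p * p) (*-mono-≤ s-bound s-bound) ⟩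
        d q * d q * (p * p)                    ∎

      high : d q * d q * (p * p) ≤ t * t * q
      high = begin
        d q * d q * (p * p)                    ≤⟨ *-monoˡ-≤ (p * p) (*-mono-≤ t-bound t-bound) ⟩
        (k * t) * (k * t) * (p * p)            ≡⟨ solve 3 (λ t k p → (k :* t) :* (k :* t) :* (p :* p) := t :* t :* (k :* p :* (k :* p))) refl t k p ⟩
        t * t * (k * p * (k * p))              ≤⟨ *-monoʳ-≤ (t * t) kp≤q ⟩
        t * t * q                              ∎

-- Comparison of rationals and the Cauchy criterion.

-- The value of frac n p is n / (1 + p).
frac : ℕ → ℕ → ℚ
frac n p = ℚ.fromℚᵘ (ℚᵘ.mkℚᵘ (ℤ.+ n) p)

-- Comparisons are moved to unnormalised fractions, where numerators and denominators stay explicit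
-- because no common factor is cancelled.
toℚᵘ-frac : ∀ n p → ℚ.toℚᵘ (frac n p) ℚᵘ.≃ ℚᵘ.mkℚᵘ (ℤ.+ n) p
toℚᵘ-frac n p = ℚₚ.toℚᵘ-fromℚᵘ (ℚᵘ.mkℚᵘ (ℤ.+ n) p)

toℚᵘ-frac² : ∀ n p q → ℚ.toℚᵘ (frac n p ℚ.* frac n p ℚ.* ℕ→ℚ q) ℚᵘ.≃
  ℚᵘ.mkℚᵘ (ℤ.+ n) p ℚᵘ.* ℚᵘ.mkℚᵘ (ℤ.+ n) p ℚᵘ.* ℚᵘ.mkℚᵘ (ℤ.+ q) 0
toℚᵘ-frac² n p q = ℚᵘₚ.≃-trans (ℚₚ.toℚᵘ-homo-* (frac n p ℚ.* frac n p) (ℕ→ℚ q))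
  (ℚᵘₚ.*-cong (ℚᵘₚ.≃-trans (ℚₚ.toℚᵘ-homo-* (frac n p) (frac n p)) (ℚᵘₚ.*-cong (toℚᵘ-frac n p) (toℚᵘ-frac n p)))
              (toℚᵘ-frac q 0))

module _ (n p q d : ℕ) where

  private
    numerator : (ℤ.+ n ℤ.* ℤ.+ n ℤ.* ℤ.+ q) ℤ.* ℤ.+ 1 ≡ ℤ.+ (n * n * q)
    numerator = trans (ℤₚ.*-identityʳ _) (sym (trans (ℤₚ.pos-* (n * n) q) (cong (ℤ._* ℤ.+ q) (ℤₚ.pos-* n n))))

    denominator : ℤ.+ (d * d) ℤ.* ℤ.+ (suc p * suc p * 1) ≡ ℤ.+ (d * d * (suc p * suc p))
    denominator = trans (sym (ℤₚ.pos-* (d * d) _)) (cong (λ m → ℤ.+ (d * d * m)) (*-identityʳ (suc p * suc p)))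

  frac²-≤ : n * n * q ≤ d * d * (suc p * suc p) → frac n p ℚ.* frac n p ℚ.* ℕ→ℚ q ℚ.≤ ℕ→ℚ (d * d)
  frac²-≤ le = ℚₚ.toℚᵘ-cancel-≤
    (ℚᵘₚ.≤-respˡ-≃ (ℚᵘₚ.≃-sym (toℚᵘ-frac² n p q)) (ℚᵘₚ.≤-respʳ-≃ (ℚᵘₚ.≃-sym (toℚᵘ-frac (d * d) 0))
      (ℚᵘ.*≤* (subst₂ ℤ._≤_ (sym numerator) (sym denominator) (ℤ.+≤+ le)))))

  ≤-frac² : d * d * (suc p * suc p) ≤ n * n * q → ℕ→ℚ (d * d) ℚ.≤ frac n p ℚ.* frac n p ℚ.* ℕ→ℚ q
  ≤-frac² le = ℚₚ.toℚᵘ-cancel-≤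
    (ℚᵘₚ.≤-respʳ-≃ (ℚᵘₚ.≃-sym (toℚᵘ-frac² n p q)) (ℚᵘₚ.≤-respˡ-≃ (ℚᵘₚ.≃-sym (toℚᵘ-frac (d * d) 0))
      (ℚᵘ.*≤* (subst₂ ℤ._≤_ (sym denominator) (sym numerator) (ℤ.+≤+ le)))))

-- A positive `ε` is at least 1 over its denominator, and by the hypothesis on `p` this equals m /
-- (1 + p).
frac-≤-+ : ∀ {l n p m} ε → 0ℚ ℚ.< ε → suc p ≡ m * ℚ.↧ₙ ε → n ≤ l + m →
           frac n p ℚ.≤ frac l p ℚ.+ ε
frac-≤-+ (mkℚ ℤ.-[1+ _ ] _ _) 0<ε with () ← ℚ.positive 0<ε
frac-≤-+ (mkℚ ℤ.+0 _ _) 0<ε with () ← ℚ.positive 0<ε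
frac-≤-+ {l} {n} {p} {m} ε@(mkℚ ℤ.+[1+ e ] b _) 0<ε p≡ n≤ = ℚₚ.toℚᵘ-cancel-≤
  (ℚᵘₚ.≤-respˡ-≃ (ℚᵘₚ.≃-sym (toℚᵘ-frac n p))
    (ℚᵘₚ.≤-respʳ-≃ (ℚᵘₚ.≃-sym (ℚᵘₚ.≃-trans (ℚₚ.toℚᵘ-homo-+ (frac l p) ε) (ℚᵘₚ.+-congˡ _ (toℚᵘ-frac l p))))
      (ℚᵘ.*≤* (subst₂ ℤ._≤_ (ℤₚ.pos-* n _) rhs (ℤ.+≤+ le)))))
  where
  open ≤-Reasoning
  open +-*-Solver
  rhs : ℤ.+ ((l * suc b + suc e * suc p) * suc p) ≡
        (ℤ.+ l ℤ.* ℤ.+ suc b ℤ.+ ℤ.+ suc e ℤ.* ℤ.+ suc p) ℤ.* ℤ.+ suc p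
  rhs = trans (ℤₚ.pos-* (l * suc b + suc e * suc p) (suc p)) (cong (ℤ._* ℤ.+ suc p)
    (trans (ℤₚ.pos-+ (l * suc b) _) (cong₂ ℤ._+_ (ℤₚ.pos-* l (suc b)) (ℤₚ.pos-* (suc e) (suc p)))))
  le : n * (suc p * suc b) ≤ (l * suc b + suc e * suc p) * suc p
  le = begin
    n * (suc p * suc b)                       ≤⟨ *-monoˡ-≤ (suc p * suc b) n≤ ⟩
    (l + m) * (suc p * suc b)                 ≡⟨ solve 4 (λ l m p b → (l :+ m) :* (p :* b) := (l :* b :+ m :* b) :* p) refl l m (suc p) (suc b) ⟩
    (l * suc b + m * suc b) * suc p           ≡⟨ cong (λ x → (l * suc b + x) * suc p) p≡ ⟨
    (l * suc b + suc p) * suc p               ≤⟨ *-monoˡ-≤ (suc p) (+-monoʳ-≤ (l * suc b) (m≤n*m (suc p) (suc e))) ⟩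
    (l * suc b + suc e * suc p) * suc p       ∎

0≤frac : ∀ n p → 0ℚ ℚ.≤ frac n p
0≤frac n p = ℚₚ.nonNegative⁻¹ (frac n p) {{ℚₚ.normalize-nonNeg n (suc p)}}

square-mono-≤ : ∀ {x y} → 0ℚ ℚ.≤ x → x ℚ.≤ y → x ℚ.* x ℚ.≤ y ℚ.* y
square-mono-≤ {x} {y} 0≤x x≤y = ℚₚ.≤-trans
  (ℚₚ.*-monoʳ-≤-nonNeg x {{ℚ.nonNegative 0≤x}} x≤y)
  (ℚₚ.*-monoˡ-≤-nonNeg y {{ℚ.nonNegative (ℚₚ.≤-trans 0≤x x≤y)}} x≤y)

convergesOverSqrt : ∀ {d : ℕ → ℕ} {C : ℕ} →
  (∀ k q r → 1 ≤ k → k * k * q ≤ r → k * d q ≤ d r + k * C) →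
  (∀ k q r → 1 ≤ k → r ≤ k * k * q → d r ≤ k * (d q + C)) →
  ConvergesOverSqrt d
convergesOverSqrt {d} {C} lower upper ε 0<ε =
  -- At scale `p`, `squeeze` encloses the quotient between s / p and t / p for every `q` past its
  -- threshold.
  frac s p-1 , (t * p) * (t * p) , λ q N≤q _ →
    let low , high = squeeze lower upper p (s≤s z≤n) q N≤q in
    inj₂ (frac²-≤ s p-1 q (d q) low) ,
    ℚₚ.≤-trans (0≤frac t p-1) t≤s+ε ,
    ℚₚ.≤-trans (≤-frac² t p-1 q (d q) high)
      (ℚₚ.*-monoʳ-≤-nonNeg (ℕ→ℚ q) {{ℚₚ.normalize-nonNeg q 1}} (square-mono-≤ (0≤frac t p-1) t≤s+ε))
  where
  -- A bound on the gap between `s` and `t`, attained unless the subtraction in `s` truncates.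
  m = suc C + suc C
  -- `frac` adds 1 to its second argument, hence `pred`. With `p` equal to `m` times the denominator
  -- of `ε`, the gap m / p is at most `ε`.
  p-1 = pred (m * ℚ.↧ₙ ε)
  p = suc p-1
  s = d (p * p) ∸ suc C
  t = d (p * p) + suc C

  t≤s+m : t ≤ s + m
  t≤s+m = ≤-trans (+-monoˡ-≤ (suc C) (m≤n+m∸n (d (p * p)) (suc C)))
    (≤-reflexive (trans (cong (_+ suc C) (+-comm (suc C) s)) (+-assoc s (suc C) (suc C))))

  t≤s+ε : frac t p-1 ℚ.≤ frac s p-1 ℚ.+ ε
  t≤s+ε = frac-≤-+ {s} {t} {p-1} {m} ε 0<ε refl t≤s+m

theorem5p2 : (a : ℕ) → 2 ≤ a → (χ : ℕ → ℕ) → ((q : ℕ) → IsChiSc2 a q (χ q)) →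
    ConvergesOverSqrt (λ q → χ q ∸ 2 * q)
theorem5p2 a _ χ isχ = convergesOverSqrt
  -- The error `k * a` is weakened to `k * (a * 2 ^ a)`, so that both bounds share one constant.
  (λ k q r 1≤k ≤r → ≤-trans (excess-lower isχ k q r 1≤k ≤r)
    (+-monoʳ-≤ (excess isχ r) (*-monoʳ-≤ k (m≤m*n a (2 ^ a) {{m^n≢0 2 a}}))))
  (excess-upper isχ)
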